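{- Let $N$ and $N'$ be image-finite labeled fluid stochastic Petri nets (LFSPNs), each having exactly one continuous place. Then $$N\leftrightarrow_{fl}N'\ \Leftrightarrow\ N=_{HML_{flb}}N',$$ i.e. $N$ and $N'$ are fluid bisimulation equivalent if and only if they are logically equivalent in the fluid modal logic $HML_{flb}$.
   Context: Notation: $\mathbb N=\{0,1,2,\ldots\}$; $Act$ is a set of actions. An LFSPN is a tuple $N=(P_N,T_N,W_N,C_N,R_N,\Omega_N,L_N,\mathcal M_N)$, where: $P_N=Pd_N\uplus Pc_N$ is a finite set of discrete places ($Pd_N$) and continuous places ($Pc_N$); $T_N$ is a finite set of transitions, $P_N\cup T_N\neq\emptyset$, $P_N\cap T_N=\emptyset$; $W_N:(Pd_N\times T_N)\cup(T_N\times Pd_N)\to\mathbb N$ gives weights of discrete arcs; $C_N\subseteq(Pc_N\times T_N)\cup(T_N\times Pc_N)$ is the set of continuous arcs; $R_N:C_N\times\mathbb N^{|Pd_N|}\to\mathbb R_{\ge0}$ gives flow rates of continuous arcs in a discrete marking; $\Omega_N:T_N\times\mathbb N^{|Pd_N|}\to\mathbb R_{>0}$ gives transition rates in a discrete marking; $L_N:T_N\to Act$ is the labeling; $\mathcal M_N=(M_N,\mathbf 0)$ is the initial marking, with $M_N\in\mathbb N^{|Pd_N|}$ the initial discrete marking and $\mathbf 0$ meaning all continuous places are empty. A discrete marking is $M:Pd_N\to\mathbb N$. $Ena(M)=\{t\in T_N\mid \forall p\in Pd_N\ W_N(p,t)\le M(p)\}$. For $t\in Ena(M)$ we write $M\stackrel{t}{\rightarrow}\widetilde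 M$, where $\widetilde M(p)=M(p)-W_N(p,t)+W_N(t,p)$ for all $p\in Pd_N$. $DRS(N)$ is the smallest set of discrete markings containing $M_N$ and closed under $\stackrel{t}{\rightarrow}$ for all $t$. For $a\in Act$, $Image(M,a)=\{\widetilde M\mid M\stackrel{t}{\rightarrow}\widetilde M,\ L_N(t)=a\}$; $N$ is image-finite if $|Image(M,a)|<\infty$ for all $M\in DRS(N)$, $a\in Act$. Let $Pc_N=\{q\}$. The potential fluid flow rate in $M\in DRS(N)$ is $$RP(M)=\sum_{\{t\in Ena(M)\mid (t,q)\in C_N\}}R_N((t,q),M)-\sum_{\{t\in Ena(M)\mid (q,t)\in C_N\}}R_N((q,t),M).$$ For $a\in Act$ and a set $\mathcal H$ of discrete markings, $RM_a(M,\mathcal H)=\sum_{\{t\mid\exists\widetilde M\in\mathcal H\ M\stackrel{t}{\rightarrow}\widetilde M,\ L_N(t)=a\}}\Omega_N(t,M)$. Fluid bisimulation. Let $Pc_N=\{q\}$, $Pc_{N'}=\{q'\}$; $q'$ corresponds to $q$, and $RP(M)$ is taken for $q$ if $M\in DRS(N)$ and for $q'$ if $M\in DRS(N')$ (likewise $RM_a$ is taken in the net to which $M$ belongs). The sets $DRS(N)$ and $DRS(N')$ are treated as disjoint. An equivalence relation $\mathcal R\subseteq(DRS(N)\cup DRS(N'))^2$ is a fluid bisimulation between $N$ and $N'$ if (1) $(M_N,M_{N'})\in\mathcal R$; (2) $(M_1,M_2)\in\mathcal R$ implies $RP(M_1)=RP(M_2)$ and, for all $\mathcal H\in(DRS(N)\cup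 DRS(N'))/_{\mathcal R}$ and all $a\in Act$, $RM_a(M_1,\mathcal H)=RM_a(M_2,\mathcal H)$. $N\leftrightarrow_{fl}N'$ iff a fluid bisimulation between $N$ and $N'$ exists. Logic $HML_{flb}$. Formulas: $\Phi::=\top\mid\neg\Phi\mid\Phi\wedge\Phi\mid\nabla_a\mid\wr_r\mid\langle a\rangle_\lambda\Phi$ with $a\in Act$, $r\in\mathbb R$, $\lambda\in\mathbb R_{>0}$; $\mathbf{HML}_{flb}$ is the set of all formulas. For $M\in DRS(N)$, satisfaction $\models_{flb}$ is defined by: $M\models_{flb}\top$ always; $M\models_{flb}\neg\Phi$ iff not $M\models_{flb}\Phi$; $M\models_{flb}\Phi\wedge\Psi$ iff $M\models_{flb}\Phi$ and $M\models_{flb}\Psi$; $M\models_{flb}\nabla_a$ iff no transition labeled $a$ is enabled in $M$ (equivalently $RM_a(M,DRS(N))=0$); $M\models_{flb}\wr_r$ iff $RP(M)=r$; $M\models_{flb}\langle a\rangle_\lambda\Phi$ iff there is $\mathcal H\subseteq DRS(N)$ with $RM_a(M,\mathcal H)\ge\lambda$ and $\widetilde M\models_{flb}\Phi$ for all $\widetilde M\in\mathcal H$. $N\models_{flb}\Phi$ means $M_N\models_{flb}\Phi$. $N=_{HML_{flb}}N'$ iff for all $\Phi\in\mathbf{HML}_{flb}$: $N\models_{flb}\Phi\Leftrightarrow N'\models_{flb}\Phi$. -}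

module Defs where

open import Axiom.ExcludedMiddle using (ExcludedMiddle)
open import Data.Bool.Base using (Bool) renaming (T to IsTrue)
open import Data.Bool.Properties using () renaming (T? to isTrue?)
open import Data.Fin.Base using (Fin)
open import Data.Fin.Properties using (all?)
open import Data.Irrelevant using ([_])
open import Data.List.Membership.Propositional using (_∈_)
open import Data.Nat.Base as ℕ using (ℕ; NonZero)
import Data.Nat.Properties as ℕ
open import Data.Product.Base using (Σ; ∃; ∃-syntax; _×_; _,_; proj₁; proj₂)
open import Data.Rational.Base as ℚ using (ℚ; 0ℚ; ½)
import Data.Rational.Properties as ℚ
open import Data.Refinement using (Refinement-syntax; value; _,_)
open import Data.Sum.Base using (_⊎_; inj₁; inj₂)
open import Data.Unit.Polymorphic.Base using (⊤)
open import Data.Vec.Base using (Vec; lookup; replicate)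
open import Data.Vec.Functional using (foldr)
open import Function.Base using (_∘_)
open import Function.Bundles using (_⇔_)
open import Level using (0ℓ; Lift) renaming (suc to lsuc)
open import Relation.Binary.Core using (Rel)
open import Relation.Binary.PropositionalEquality
  using (_≡_; sym; trans; cong; subst; subst₂)
open import Relation.Binary.Structures using (IsEquivalence)
open import Relation.Nullary.Decidable.Core using (Dec; yes; no; _×-dec_)
open import Relation.Nullary.Negation.Core using (¬_)
open import Relation.Unary using (Pred; Decidable; _≐_)

-- Real numbers: Cantor's construction, as rational Cauchy sequences
-- under the setoid equality _≈_.

record ℝ : Set where
  constructor mkℝ
  field
    seq    : ℕ → ℚ
    cauchy : ∀ ε → 0ℚ ℚ.< ε →
             ∃[ k ] ∀ m n → k ℕ.≤ m → k ℕ.≤ n → ℚ.∣ seq m ℚ.- seq n ∣ ℚ.< ε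

open ℝ public

infix 4 _≈_ _≤_ _<_ _≥_
infixl 6 _+_ _-_
infix 8 -_

_≈_ : Rel ℝ 0ℓ
x ≈ y = ∀ ε → 0ℚ ℚ.< ε →
        ∃[ k ] ∀ n → k ℕ.≤ n → ℚ.∣ seq x n ℚ.- seq y n ∣ ℚ.< ε

_≤_ : Rel ℝ 0ℓ
x ≤ y = ∀ ε → 0ℚ ℚ.< ε → ∃[ k ] ∀ n → k ℕ.≤ n → seq x n ℚ.≤ seq y n ℚ.+ ε

_<_ : Rel ℝ 0ℓ
x < y = ∃[ ε ] 0ℚ ℚ.< ε × ∃[ k ] ∀ n → k ℕ.≤ n → seq x n ℚ.+ ε ℚ.≤ seq y n

_≥_ : Rel ℝ 0ℓ
x ≥ y = y ≤ x

private
  module ℚ-lemmas where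
    open import Algebra.Bundles using (CommutativeMonoid)
    open import Algebra.Properties.CommutativeSemigroup
      (CommutativeMonoid.commutativeSemigroup ℚ.+-0-commutativeMonoid)
      using (interchange)

    half-pos : ∀ {ε} → 0ℚ ℚ.< ε → 0ℚ ℚ.< ½ ℚ.* ε
    half-pos {ε} 0<ε =
      subst (ℚ._< ½ ℚ.* ε) (ℚ.*-zeroʳ ½) (ℚ.*-monoʳ-<-pos ½ 0<ε)

    half+half : ∀ ε → ½ ℚ.* ε ℚ.+ ½ ℚ.* ε ≡ ε
    half+half ε = trans (sym (ℚ.*-distribʳ-+ ε ½ ½)) (ℚ.*-identityˡ ε)

    +-diff : ∀ a b c d →
             (a ℚ.+ b) ℚ.- (c ℚ.+ d) ≡ (a ℚ.- c) ℚ.+ (b ℚ.- d)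
    +-diff a b c d = trans (cong (a ℚ.+ b ℚ.+_) (ℚ.neg-distrib-+ c d))
                           (interchange a b (ℚ.- c) (ℚ.- d))

    neg-diff : ∀ a b → ℚ.∣ ℚ.- a ℚ.- ℚ.- b ∣ ≡ ℚ.∣ a ℚ.- b ∣
    neg-diff a b = trans (cong ℚ.∣_∣ (sym (ℚ.neg-distrib-+ a (ℚ.- b))))
                         (ℚ.∣-p∣≡∣p∣ (a ℚ.- b))

open ℚ-lemmas

0ℝ : ℝ
0ℝ = mkℝ (λ _ → 0ℚ) (λ ε 0<ε → 0 , λ _ _ _ _ → 0<ε)

_+_ : ℝ → ℝ → ℝ
x + y = mkℝ (λ n → seq x n ℚ.+ seq y n) λ ε 0<ε →
  let k , p = cauchy x (½ ℚ.* ε) (half-pos 0<ε)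
      l , q = cauchy y (½ ℚ.* ε) (half-pos 0<ε)
  in k ℕ.⊔ l , λ m n hm hn →
     subst₂ ℚ._<_ (cong ℚ.∣_∣ (sym (+-diff (seq x m) (seq y m) (seq x n) (seq y n))))
                  (half+half ε)
       (ℚ.≤-<-trans
         (ℚ.∣p+q∣≤∣p∣+∣q∣ (seq x m ℚ.- seq x n) (seq y m ℚ.- seq y n))
         (ℚ.+-mono-< (p m n (ℕ.m⊔n≤o⇒m≤o k l hm) (ℕ.m⊔n≤o⇒m≤o k l hn))
                     (q m n (ℕ.m⊔n≤o⇒n≤o k l hm) (ℕ.m⊔n≤o⇒n≤o k l hn))))

-_ : ℝ → ℝ
- x = mkℝ (λ n → ℚ.- seq x n) λ ε 0<ε →
  let k , p = cauchy x ε 0<ε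
  in k , λ m n hm hn →
     subst (ℚ._< ε) (sym (neg-diff (seq x m) (seq x n))) (p m n hm hn)

_-_ : ℝ → ℝ → ℝ
x - y = x + (- y)

ℝ≥0 : Set
ℝ≥0 = ∃[ x ] 0ℝ ≤ x

ℝ>0 : Set
ℝ>0 = ∃[ x ] 0ℝ < x

-- Σ_{i ∈ P} f i, where f need only be defined on P.
sum : ∀ {n} {P : Pred (Fin n) 0ℓ} → Decidable P → (∀ i → P i → ℝ) → ℝ
sum {P = P} P? f = foldr _+_ 0ℝ (λ i → term i (P? i))
  where
  term : ∀ i → Dec (P i) → ℝ
  term i (yes p) = f i p
  term i (no  _) = 0ℝ

-- Places and transitions are taken from separate finite types, so that
-- P_N = Pd ⊎ Pc and P_N ∩ T_N = ∅ hold by construction.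
record LFSPN (Act : Set) : Set where
  field
    #Pd #Pc #T : ℕ
    P∪T≢∅      : NonZero (#Pd ℕ.+ #Pc ℕ.+ #T)

  Pd : Set
  Pd = Fin #Pd

  Pc : Set
  Pc = Fin #Pc

  T : Set
  T = Fin #T

  Marking : Set
  Marking = Vec ℕ #Pd

  DArc : Set
  DArc = (Pd × T) ⊎ (T × Pd)

  CArc : Set
  CArc = (Pc × T) ⊎ (T × Pc)

  field
    W  : DArc → ℕ
    C  : CArc → Bool
    R  : (Σ CArc λ c → IsTrue (C c)) → Marking → ℝ≥0
    Ω  : T → Marking → ℝ>0
    L  : T → Act
    M₀ : Marking

  𝓜₀ : Marking × Vec ℝ #Pc
  𝓜₀ = M₀ , replicate #Pc 0ℝ

module Net {Act : Set} (N : LFSPN Act) where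
  open LFSPN N public

  Ena : Marking → Pred T 0ℓ
  Ena M t = ∀ p → W (inj₁ (p , t)) ℕ.≤ lookup M p

  Ena? : ∀ M → Decidable (Ena M)
  Ena? M t = all? (λ p → W (inj₁ (p , t)) ℕ.≤? lookup M p)

  -- The truncated subtraction is exact, since t is enabled in M.
  _—[_]→_ : Marking → T → Marking → Set
  M —[ t ]→ M̃ = Ena M t ×
    (∀ p → lookup M̃ p ≡ lookup M p ℕ.∸ W (inj₁ (p , t)) ℕ.+ W (inj₂ (t , p)))

  data DRS : Pred Marking 0ℓ where
    init : DRS M₀
    step : ∀ {M t M̃} → DRS M → M —[ t ]→ M̃ → DRS M̃

  -- DRS(N) as a type.  Membership is recorded irrelevantly, so that a
  -- marking reachable in several ways is still a single element.
  State : Set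
  State = [ M ∈ Marking ∣ DRS M ]

  s₀ : State
  s₀ = M₀ , [ init ]

  Image : Marking → Act → Pred Marking 0ℓ
  Image M a M̃ = ∃[ t ] M —[ t ]→ M̃ × L t ≡ a

  ImageFinite : Set
  ImageFinite = ∀ (M : State) a →
    ∃[ Ms ] ∀ M̃ → Image (value M) a M̃ → M̃ ∈ Ms

  RP : Pc → Marking → ℝ
  RP q M =
      sum (λ t → Ena? M t ×-dec isTrue? (C (inj₂ (t , q))))
          (λ t (_ , c) → proj₁ (R (inj₂ (t , q) , c) M))
    - sum (λ t → Ena? M t ×-dec isTrue? (C (inj₁ (q , t))))
          (λ t (_ , c) → proj₁ (R (inj₁ (q , t) , c) M))

infixr 6 _∧′_

data Formula (Act : Set) : Set where
  ⊤′     : Formula Act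
  ¬′_    : Formula Act → Formula Act
  _∧′_   : Formula Act → Formula Act → Formula Act
  ∇      : Act → Formula Act
  ≀      : ℝ → Formula Act
  ⟨_⟩[_]_ : Act → ℝ>0 → Formula Act → Formula Act

IsClassOf : {X : Set} → Rel X 0ℓ → Pred X 0ℓ → Set
IsClassOf _∼_ H = ∃[ x ] H ≐ (x ∼_)

-- Membership of a marking in an arbitrary set of markings is not
-- decidable, so even the definition of RM as a sum over such a set is
-- classical; hence the parameter em.
module Classical (em : ∀ {ℓ} → ExcludedMiddle ℓ) {Act : Set} where

  module _ (N : LFSPN Act) where
    open Net N

    RM : Act → State → Pred State 0ℓ → ℝ
    RM a M H =
      sum {P = λ t → ∃[ M̃ ] H M̃ × value M —[ t ]→ value M̃ × L t ≡ a}
          (λ _ → em) (λ t _ → proj₁ (Ω t (value M)))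

    Sat : Pc → State → Formula Act → Set₁
    Sat q M ⊤′             = ⊤
    Sat q M (¬′ Φ)         = ¬ Sat q M Φ
    Sat q M (Φ ∧′ Ψ)       = Sat q M Φ × Sat q M Ψ
    Sat q M (∇ a)          = Lift _ (∀ t → L t ≡ a → ¬ Ena (value M) t)
    Sat q M (≀ r)          = Lift _ (RP q (value M) ≈ r)
    Sat q M (⟨ a ⟩[ λ′ ] Φ) =
      Σ (Pred State 0ℓ) λ H →
        RM a M H ≥ proj₁ λ′ × (∀ M̃ → H M̃ → Sat q M̃ Φ)

  module _ (N : LFSPN Act) (q : LFSPN.Pc N)
           (N′ : LFSPN Act) (q′ : LFSPN.Pc N′) where
    private
      module N  = Net N
      module N′ = Net N′

    States : Set
    States = N.State ⊎ N′.State

    RP⊎ : States → ℝ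
    RP⊎ (inj₁ M) = N.RP q (value M)
    RP⊎ (inj₂ M) = N′.RP q′ (value M)

    RM⊎ : Act → States → Pred States 0ℓ → ℝ
    RM⊎ a (inj₁ M) H = RM N a M (H ∘ inj₁)
    RM⊎ a (inj₂ M) H = RM N′ a M (H ∘ inj₂)

    record IsFluidBisimulation (_∼_ : Rel States 0ℓ) : Set₁ where
      field
        isEquivalence : IsEquivalence _∼_
        initial       : inj₁ N.s₀ ∼ inj₂ N′.s₀
        RP-resp       : ∀ {M₁ M₂} → M₁ ∼ M₂ → RP⊎ M₁ ≈ RP⊎ M₂
        RM-resp       : ∀ {M₁ M₂} → M₁ ∼ M₂ → ∀ H → IsClassOf _∼_ H →
                        ∀ a → RM⊎ a M₁ H ≈ RM⊎ a M₂ H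

    FluidBisimilar : Set₁
    FluidBisimilar = Σ (Rel States 0ℓ) IsFluidBisimulation

    LogicallyEquivalent : Set₁
    LogicallyEquivalent = ∀ Φ → Sat N q N.s₀ Φ ⇔ Sat N′ q′ N′.s₀ Φ

{-# OPTIONS --safe #-}
module Submission where

-- Hennessy–Milner argument.  A formula ⟨ a ⟩[ λ′ ] Φ satisfied in M through a
-- set H is satisfied in any bisimilar state through the union of the finitely
-- many classes met by the a-successors of M in H, by additivity of the rate RM.
-- Conversely, logical equivalence is itself a fluid bisimulation: for a class H
-- and states s₁, s₂ in one class, finitely many distinguishing formulas combine
-- to a formula Φ true on H and false at every a-successor of s₂ outside H, and
-- ⟨ a ⟩[ λ′ ] Φ with λ′ the rate of s₁ into H bounds the rate of s₂ from below.

open import Defs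
open import Algebra.Bundles using (CommutativeMonoid)
open import Axiom.ExcludedMiddle using (ExcludedMiddle)
open import Data.Empty using (⊥; ⊥-elim-irr)
open import Data.Fin.Base using (Fin; zero; suc)
open import Data.Irrelevant using ([_])
open import Data.List.Base as List using (List; []; _∷_; filter)
open import Data.List.Membership.Propositional using (_∈_; find)
open import Data.List.Membership.Propositional.Properties using (∈-map⁺; ∈-filter⁺; ∈-filter⁻)
open import Data.List.Relation.Unary.Any as Any using (Any; here; there)
open import Data.Nat.Base as ℕ using (ℕ)
import Data.Nat.Properties as ℕ
open import Data.Product.Base as Product using (Σ; ∃; ∃-syntax; _×_; _,_; proj₁; proj₂)
open import Data.Rational.Base as ℚ using (0ℚ; ½)
import Data.Rational.Properties as ℚ
open import Data.Refinement using (value; value-injective; _,_)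
open import Data.Sum.Base as Sum using (_⊎_; inj₁; inj₂; [_,_]′)
open import Data.Vec.Base using (lookup; tabulate)
open import Data.Vec.Properties using (tabulate-cong; tabulate∘lookup; lookup∘tabulate)
open import Function.Base using (_∘_)
open import Function.Bundles using (_⇔_; mk⇔; module Equivalence)
open import Function.Construct.Composition using (_⇔-∘_)
open import Function.Construct.Identity using (⇔-id)
open import Function.Construct.Symmetry using (⇔-sym)
open import Level using (0ℓ; lift; lower)
open import Relation.Binary.Core using (Rel)
open import Relation.Binary.PropositionalEquality
  using (_≡_; _≗_; refl; sym; trans; cong; cong₂; subst; subst₂)
open import Relation.Binary.Structures using (IsEquivalence)
open import Relation.Nullary.Decidable
  using (Dec; yes; no; True; toWitness; fromWitness; decidable-stable)
open import Relation.Nullary.Negation.Core using (¬_; contradiction)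
open import Relation.Unary using (Pred; Decidable; ∅; _≐_)

open import Algebra.Properties.AbelianGroup ℚ.+-0-abelianGroup using (xyx⁻¹≈y; ⁻¹-anti-homo‿-)
open import Algebra.Properties.CommutativeSemigroup
  (CommutativeMonoid.commutativeSemigroup ℚ.+-0-commutativeMonoid) using (interchange)
open import Algebra.Properties.Group ℚ.+-0-group using (//-rightDividesˡ; //-rightDividesʳ)
open Equivalence using (to; from)

-- Rational inequalities and the order on Cauchy reals

½*-pos : ∀ {ε} → 0ℚ ℚ.< ε → 0ℚ ℚ.< ½ ℚ.* ε
½*-pos {ε} 0<ε = subst (ℚ._< ½ ℚ.* ε) (ℚ.*-zeroʳ ½) (ℚ.*-monoʳ-<-pos ½ 0<ε)

½*+½* : ∀ ε → ½ ℚ.* ε ℚ.+ ½ ℚ.* ε ≡ ε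
½*+½* ε = trans (sym (ℚ.*-distribʳ-+ ε ½ ½)) (ℚ.*-identityˡ ε)

p<p+ε : ∀ p {ε} → 0ℚ ℚ.< ε → p ℚ.< p ℚ.+ ε
p<p+ε p {ε} 0<ε = subst (ℚ._< p ℚ.+ ε) (ℚ.+-identityʳ p) (ℚ.+-monoʳ-< p 0<ε)

½*ε<ε : ∀ {ε} → 0ℚ ℚ.< ε → ½ ℚ.* ε ℚ.< ε
½*ε<ε {ε} 0<ε = subst (½ ℚ.* ε ℚ.<_) (½*+½* ε) (p<p+ε (½ ℚ.* ε) (½*-pos 0<ε))

p≤∣p∣ : ∀ p → p ℚ.≤ ℚ.∣ p ∣
p≤∣p∣ p with ℚ.≤-total 0ℚ p
... | inj₁ 0≤p = ℚ.≤-reflexive (sym (ℚ.0≤p⇒∣p∣≡p 0≤p))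
... | inj₂ p≤0 = ℚ.≤-trans p≤0 (ℚ.0≤∣p∣ p)

p≤q+ε⇒p-q≤ε : ∀ {p q ε} → p ℚ.≤ q ℚ.+ ε → p ℚ.- q ℚ.≤ ε
p≤q+ε⇒p-q≤ε {p} {q} {ε} h =
  subst (p ℚ.- q ℚ.≤_) (xyx⁻¹≈y q ε) (ℚ.+-monoˡ-≤ (ℚ.- q) h)

-- _≈_, _≤_ and _<_ unfold to statements about the underlying sequences, from
-- which the reals cannot be inferred: hence the many explicit instantiations.
≤-refl : ∀ {x} → x ≤ x
≤-refl {x} ε 0<ε = 0 , λ n _ → ℚ.<⇒≤ (p<p+ε (seq x n) 0<ε)

≤-trans : ∀ {x y z} → x ≤ y → y ≤ z → x ≤ z
≤-trans {x} {y} {z} x≤y y≤z ε 0<ε =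
  let k , p = x≤y (½ ℚ.* ε) (½*-pos 0<ε)
      l , q = y≤z (½ ℚ.* ε) (½*-pos 0<ε)
  in k ℕ.⊔ l , λ n hn →
     subst (seq x n ℚ.≤_)
       (trans (ℚ.+-assoc (seq z n) _ _) (cong (seq z n ℚ.+_) (½*+½* ε)))
       (ℚ.≤-trans (p n (ℕ.m⊔n≤o⇒m≤o k l hn))
                  (ℚ.+-monoˡ-≤ (½ ℚ.* ε) (q n (ℕ.m⊔n≤o⇒n≤o k l hn))))

≤-antisym : ∀ {x y} → x ≤ y → y ≤ x → x ≈ y
≤-antisym {x} {y} x≤y y≤x ε 0<ε =
  -- Half of `ε`, because the two hypotheses bound the distance only weakly, whereas `_≈_` asks for
  -- a strict bound.
  let k , p = x≤y (½ ℚ.* ε) (½*-pos 0<ε)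
      l , q = y≤x (½ ℚ.* ε) (½*-pos 0<ε)
  in k ℕ.⊔ l , λ n hn →
     ℚ.≤-<-trans (bound (seq x n) (seq y n) (p n (ℕ.m⊔n≤o⇒m≤o k l hn)) (q n (ℕ.m⊔n≤o⇒n≤o k l hn)))
                 (½*ε<ε 0<ε)
  where
  bound : ∀ a b {δ} → a ℚ.≤ b ℚ.+ δ → b ℚ.≤ a ℚ.+ δ → ℚ.∣ a ℚ.- b ∣ ℚ.≤ δ
  bound a b {δ} h h′ with ℚ.∣p∣≡p∨∣p∣≡-p (a ℚ.- b)
  ... | inj₁ e = subst (ℚ._≤ δ) (sym e) (p≤q+ε⇒p-q≤ε h)
  ... | inj₂ e = subst (ℚ._≤ δ)
                   (sym (trans e (⁻¹-anti-homo‿- a b)))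
                   (p≤q+ε⇒p-q≤ε h′)

≈⇒≤ : ∀ {x y} → x ≈ y → x ≤ y
≈⇒≤ {x} {y} x≈y ε 0<ε =
  let k , p = x≈y ε 0<ε
  in k , λ n hn →
     subst₂ ℚ._≤_ (//-rightDividesˡ (seq y n) (seq x n)) (ℚ.+-comm ε (seq y n))
       (ℚ.+-monoˡ-≤ (seq y n)
         (ℚ.≤-trans (p≤∣p∣ (seq x n ℚ.- seq y n)) (ℚ.<⇒≤ (p n hn))))

≈-sym : ∀ {x y} → x ≈ y → y ≈ x
≈-sym {x} {y} x≈y ε 0<ε =
  let k , p = x≈y ε 0<ε
  in k , λ n hn → subst (ℚ._< ε)
       (trans (sym (ℚ.∣-p∣≡∣p∣ (seq x n ℚ.- seq y n)))
              (cong ℚ.∣_∣ (⁻¹-anti-homo‿- (seq x n) (seq y n))))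
       (p n hn)

≈-trans : ∀ {x y z} → x ≈ y → y ≈ z → x ≈ z
≈-trans {x} {y} {z} x≈y y≈z = ≤-antisym {x} {z}
  (≤-trans {x} {y} {z} (≈⇒≤ {x} {y} x≈y) (≈⇒≤ {y} {z} y≈z))
  (≤-trans {z} {y} {x} (≈⇒≤ {z} {y} (≈-sym {y} {z} y≈z)) (≈⇒≤ {y} {x} (≈-sym {x} {y} x≈y)))

-- Addition acts termwise on sequences, so the monoid laws for reals follow from those for rationals
-- through this.
≗⇒≈ : ∀ {x y} → seq x ≗ seq y → x ≈ y
≗⇒≈ {x} {y} e ε 0<ε = 0 , λ n _ →
  subst (ℚ._< ε) (cong ℚ.∣_∣ (sym (trans (cong (ℚ._- seq y n) (e n)) (ℚ.+-inverseʳ (seq y n))))) 0<ε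

+-mono-≤ : ∀ {x y u v} → x ≤ y → u ≤ v → x + u ≤ y + v
+-mono-≤ {x} {y} {u} {v} x≤y u≤v ε 0<ε =
  let k , p = x≤y (½ ℚ.* ε) (½*-pos 0<ε)
      l , q = u≤v (½ ℚ.* ε) (½*-pos 0<ε)
  in k ℕ.⊔ l , λ n hn →
     subst (seq x n ℚ.+ seq u n ℚ.≤_)
       (trans (interchange (seq y n) _ (seq v n) _)
              (cong (seq y n ℚ.+ seq v n ℚ.+_) (½*+½* ε)))
       (ℚ.+-mono-≤ (p n (ℕ.m⊔n≤o⇒m≤o k l hn)) (q n (ℕ.m⊔n≤o⇒n≤o k l hn)))

+-cong : ∀ {x y u v} → x ≈ y → u ≈ v → x + u ≈ y + v
+-cong {x} {y} {u} {v} x≈y u≈v = ≤-antisym {x + u} {y + v}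
  (+-mono-≤ {x} {y} {u} {v} (≈⇒≤ {x} {y} x≈y) (≈⇒≤ {u} {v} u≈v))
  (+-mono-≤ {y} {x} {v} {u} (≈⇒≤ {y} {x} (≈-sym {x} {y} x≈y)) (≈⇒≤ {v} {u} (≈-sym {u} {v} u≈v)))

<⇒≤ : ∀ {x y} → x < y → x ≤ y
<⇒≤ {x} {y} (δ , 0<δ , k , p) ε 0<ε = k , λ n hn →
  ℚ.≤-trans (ℚ.<⇒≤ (p<p+ε (seq x n) 0<δ))
            (ℚ.≤-trans (p n hn) (ℚ.<⇒≤ (p<p+ε (seq y n) 0<ε)))

<-≤-trans : ∀ {x y z} → x < y → y ≤ z → x < z
<-≤-trans {x} {y} {z} (ε , 0<ε , k , p) y≤z =
  -- The gap `ε` is split: one half absorbs the error allowed by `y≤z`, the other remains as the gap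
  -- below `z`.
  let δ     = ½ ℚ.* ε
      l , q = y≤z δ (½*-pos 0<ε)
  in δ , ½*-pos 0<ε , k ℕ.⊔ l , λ n hn →
     let xₙ = seq x n ; zₙ = seq z n
         x+δ+δ≤z+δ = subst (ℚ._≤ zₙ ℚ.+ δ)
           (trans (cong (xₙ ℚ.+_) (sym (½*+½* ε))) (sym (ℚ.+-assoc xₙ δ δ)))
           (ℚ.≤-trans (p n (ℕ.m⊔n≤o⇒m≤o k l hn)) (q n (ℕ.m⊔n≤o⇒n≤o k l hn)))
     in subst₂ ℚ._≤_ (//-rightDividesʳ δ (xₙ ℚ.+ δ)) (//-rightDividesʳ δ zₙ)
          (ℚ.+-monoˡ-≤ (ℚ.- δ) x+δ+δ≤z+δ)

<-irrefl : ∀ {x} → ¬ x < x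
<-irrefl {x} (ε , 0<ε , k , p) =
  ℚ.<-irrefl refl (ℚ.<-≤-trans (p<p+ε (seq x k) 0<ε) (p k ℕ.≤-refl))

-- The additive monoid of the reals and its finite sums

+-0-commutativeMonoid : CommutativeMonoid 0ℓ 0ℓ
+-0-commutativeMonoid = record
  { Carrier = ℝ
  ; _≈_     = _≈_
  ; _∙_     = _+_
  ; ε       = 0ℝ
  ; isCommutativeMonoid = record
    { isMonoid = record
      { isSemigroup = record
        { isMagma = record
          { isEquivalence = record
            { refl  = λ {x} → ≗⇒≈ {x} {x} λ _ → refl
            ; sym   = λ {x} {y} → ≈-sym {x} {y}
            ; trans = λ {x} {y} {z} → ≈-trans {x} {y} {z}
            }
          ; ∙-cong = λ {x} {y} {u} {v} → +-cong {x} {y} {u} {v}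
          }
        ; assoc = λ x y z → ≗⇒≈ {x + y + z} {x + (y + z)} λ n → ℚ.+-assoc (seq x n) (seq y n) (seq z n)
        }
      ; identity = (λ x → ≗⇒≈ {0ℝ + x} {x} λ n → ℚ.+-identityˡ (seq x n))
                 , (λ x → ≗⇒≈ {x + 0ℝ} {x} λ n → ℚ.+-identityʳ (seq x n))
      }
    ; comm = λ x y → ≗⇒≈ {x + y} {y + x} λ n → ℚ.+-comm (seq x n) (seq y n)
    }
  }

open CommutativeMonoid +-0-commutativeMonoid
  using () renaming (identityˡ to +-identityˡ; identityʳ to +-identityʳ; refl to ≈-refl)
open import Algebra.Properties.CommutativeMonoid.Sum +-0-commutativeMonoid
  using (sum-cong-≗; sum-cong-≋; sum-replicate-zero; ∑-distrib-+) renaming (sum to ∑)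

∑-mono-≤ : ∀ {n} {u v : Fin n → ℝ} → (∀ i → u i ≤ v i) → ∑ u ≤ ∑ v
∑-mono-≤ {ℕ.zero}  _             = ≤-refl {0ℝ}
∑-mono-≤ {ℕ.suc n} {u} {v} u≤v = +-mono-≤ {u zero} {v zero} {∑ (u ∘ suc)} {∑ (v ∘ suc)}
  (u≤v zero) (∑-mono-≤ (u≤v ∘ suc))

0≤∑ : ∀ {n} {u : Fin n → ℝ} → (∀ i → 0ℝ ≤ u i) → 0ℝ ≤ ∑ u
0≤∑ {n} {u} 0≤u = ≤-trans {0ℝ} {∑ {n} (λ _ → 0ℝ)} {∑ u}
  (≈⇒≤ {0ℝ} {∑ {n} (λ _ → 0ℝ)} (≈-sym {∑ {n} (λ _ → 0ℝ)} {0ℝ} (sum-replicate-zero n)))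
  (∑-mono-≤ 0≤u)

term≤∑ : ∀ {n} {u : Fin n → ℝ} → (∀ i → 0ℝ ≤ u i) → ∀ i → u i ≤ ∑ u
term≤∑ {u = u} 0≤u zero = ≤-trans {u zero} {u zero + 0ℝ} {∑ u}
  (≈⇒≤ {u zero} {u zero + 0ℝ} (≈-sym {u zero + 0ℝ} {u zero} (+-identityʳ (u zero))))
  (+-mono-≤ {u zero} {u zero} {0ℝ} {∑ (u ∘ suc)} (≤-refl {u zero}) (0≤∑ (0≤u ∘ suc)))
term≤∑ {u = u} 0≤u (suc i) = ≤-trans {u (suc i)} {0ℝ + u (suc i)} {∑ u}
  (≈⇒≤ {u (suc i)} {0ℝ + u (suc i)} (≈-sym {0ℝ + u (suc i)} {u (suc i)} (+-identityˡ (u (suc i)))))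
  (+-mono-≤ {0ℝ} {u zero} {u (suc i)} {∑ (u ∘ suc)} (0≤u zero) (term≤∑ (0≤u ∘ suc) i))

-- Sums over a subset as sums of indicator terms

-- The decision serves as an indicator coefficient: a sum over a predicate becomes a sum over all of
-- `Fin n`, where the general laws of `∑` apply.
_·_ : {A : Set} → Dec A → ℝ → ℝ
yes _ · x = x
no  _ · x = 0ℝ

·-∅ : {A : Set} (A? : Dec A) {x : ℝ} → ¬ A → A? · x ≈ 0ℝ
·-∅ (yes a) ¬a = contradiction a ¬a
·-∅ (no  _) ¬a = ≈-refl {0ℝ}

·-pos : {A : Set} (A? : Dec A) {x : ℝ} → 0ℝ < x → A → 0ℝ < A? · x
·-pos (yes _) 0<x _ = 0<x
·-pos (no ¬a) 0<x a = contradiction a ¬a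

·-nonneg : {A : Set} (A? : Dec A) {x : ℝ} → 0ℝ ≤ x → 0ℝ ≤ A? · x
·-nonneg (yes _) 0≤x = 0≤x
·-nonneg (no  _) 0≤x = ≤-refl {0ℝ}

·-mono-≤ : {A B : Set} (A? : Dec A) (B? : Dec B) {x : ℝ} → 0ℝ ≤ x →
           (A → B) → A? · x ≤ B? · x
·-mono-≤ (yes _) (yes _) {x} _  _   = ≤-refl {x}
·-mono-≤ (yes a) (no ¬b) _   A⇒B = contradiction (A⇒B a) ¬b
·-mono-≤ (no  _) B?      0≤x _   = ·-nonneg B? 0≤x

·-⊎ : {A B C : Set} (A? : Dec A) (B? : Dec B) (C? : Dec C) {x : ℝ} →
      (B → ¬ C) → (A → B ⊎ C) → (B ⊎ C → A) → A? · x ≈ B? · x + C? · x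
·-⊎ _       (yes b) (yes c)     B⇒¬C _     _     = contradiction c (B⇒¬C b)
·-⊎ (yes _) (yes _) (no  _) {x} _    _     _     = ≈-sym {x + 0ℝ} {x} (+-identityʳ x)
·-⊎ (yes _) (no  _) (yes _) {x} _    _     _     = ≈-sym {0ℝ + x} {x} (+-identityˡ x)
·-⊎ (yes a) (no ¬b) (no ¬c)     _    A⇒B⊎C _     = contradiction (A⇒B⊎C a) [ ¬b , ¬c ]′
·-⊎ (no ¬a) (yes b) (no  _)     _    _     B⊎C⇒A = contradiction (B⊎C⇒A (inj₁ b)) ¬a
·-⊎ (no ¬a) (no  _) (yes c)     _    _     B⊎C⇒A = contradiction (B⊎C⇒A (inj₂ c)) ¬a
·-⊎ (no  _) (no  _) (no  _)     _    _     _     = ≈-sym {0ℝ + 0ℝ} {0ℝ} (+-identityˡ 0ℝ)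

mutual
  sum≡∑ : ∀ {n} {P : Pred (Fin n) 0ℓ} (P? : Decidable P) (w : Fin n → ℝ) →
          sum P? (λ i _ → w i) ≡ ∑ (λ i → P? i · w i)
  sum≡∑ P? w = sum-cong-≗ (λ i → summand P? w i)

  -- The summand of sum is a local function of Defs, which has no name
  -- here: the left-hand side is found by unification in sum≡∑.
  summand : ∀ {n} {P : Pred (Fin n) 0ℓ} (P? : Decidable P) (w : Fin n → ℝ) →
            ∀ i → _ ≡ P? i · w i
  summand P? w i with P? i
  ... | yes _ = refl
  ... | no  _ = refl

module _ {n} {P : Pred (Fin n) 0ℓ} (P? : Decidable P) {w : Fin n → ℝ} where

  sum-∅ : (∀ i → ¬ P i) → sum P? (λ i _ → w i) ≈ 0ℝ
  sum-∅ ¬P = subst (_≈ 0ℝ) (sym (sum≡∑ P? w))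
    (≈-trans {∑ (λ i → P? i · w i)} {∑ {n} (λ _ → 0ℝ)} {0ℝ}
      (sum-cong-≋ {n} {λ i → P? i · w i} {λ _ → 0ℝ} (λ i → ·-∅ (P? i) {w i} (¬P i)))
      (sum-replicate-zero n))

  sum-pos : (∀ i → 0ℝ < w i) → ∀ {i} → P i → 0ℝ < sum P? (λ i _ → w i)
  sum-pos 0<w {i} p = subst (0ℝ <_) (sym (sum≡∑ P? w))
    (<-≤-trans {0ℝ} {P? i · w i} {∑ (λ i → P? i · w i)}
      (·-pos (P? i) {w i} (0<w i) p)
      (term≤∑ (λ i → ·-nonneg (P? i) {w i} (<⇒≤ {0ℝ} {w i} (0<w i))) i))

  sum-mono-≤ : ∀ {Q : Pred (Fin n) 0ℓ} (Q? : Decidable Q) → (∀ i → 0ℝ ≤ w i) →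
               (∀ i → P i → Q i) → sum P? (λ i _ → w i) ≤ sum Q? (λ i _ → w i)
  sum-mono-≤ Q? 0≤w P⊆Q = subst₂ _≤_ (sym (sum≡∑ P? w)) (sym (sum≡∑ Q? w))
    (∑-mono-≤ {n} {λ i → P? i · w i} {λ i → Q? i · w i}
      (λ i → ·-mono-≤ (P? i) (Q? i) {w i} (0≤w i) (P⊆Q i)))

  sum-⊎ : ∀ {Q R : Pred (Fin n) 0ℓ} (Q? : Decidable Q) (R? : Decidable R) →
          (∀ i → Q i → ¬ R i) → (∀ i → P i → Q i ⊎ R i) → (∀ i → Q i ⊎ R i → P i) →
          sum P? (λ i _ → w i) ≈ sum Q? (λ i _ → w i) + sum R? (λ i _ → w i)
  sum-⊎ Q? R? Q∩R≡∅ P⊆Q∪R Q∪R⊆P =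
    subst₂ _≈_ (sym (sum≡∑ P? w)) (sym (cong₂ _+_ (sum≡∑ Q? w) (sum≡∑ R? w)))
      (≈-trans {∑ (λ i → P? i · w i)} {∑ (λ i → Q? i · w i + R? i · w i)}
               {∑ (λ i → Q? i · w i) + ∑ (λ i → R? i · w i)}
        (sum-cong-≋ {n} {λ i → P? i · w i} {λ i → Q? i · w i + R? i · w i}
          (λ i → ·-⊎ (P? i) (Q? i) (R? i) {w i} (Q∩R≡∅ i) (P⊆Q∪R i) (Q∪R⊆P i)))
        (∑-distrib-+ (λ i → Q? i · w i) (λ i → R? i · w i)))

module _ (em : ∀ {ℓ} → ExcludedMiddle ℓ) {Act : Set} where

  open Classical em {Act}

  -- Successors and rates within one net

  module _ (N : LFSPN Act) where

    open Net N

    Succ : Act → State → Pred State 0ℓ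
    Succ a M M̃ = Image (value M) a (value M̃)

    -- The firing rule fixes every entry of the target, and since reachability is recorded
    -- irrelevantly, equal markings are equal states.
    →-deterministic : ∀ (M : State) {t} {M₁ M₂ : State} →
                      value M —[ t ]→ value M₁ → value M —[ t ]→ value M₂ → M₁ ≡ M₂
    →-deterministic _ {M₁ = M₁} {M₂} (_ , e₁) (_ , e₂) = value-injective
      (trans (sym (tabulate∘lookup (value M₁)))
        (trans (tabulate-cong λ p → trans (e₁ p) (sym (e₂ p)))
               (tabulate∘lookup (value M₂))))

    -- Links `∇`, which speaks of enabled transitions, to successors: the marking obtained by firing
    -- is reachable again, hence a state.
    Ena⇒Succ : ∀ (M : State) {t} → Ena (value M) t → ∃ (Succ (L t) M)
    Ena⇒Succ (M , [ d ]) {t} e = (M̃ , [ step d M→M̃ ]) , t , M→M̃ , refl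
      where
      M̃ : Marking
      M̃ = tabulate λ p → lookup M p ℕ.∸ W (inj₁ (p , t)) ℕ.+ W (inj₂ (t , p))

      M→M̃ : M —[ t ]→ M̃
      M→M̃ = e , lookup∘tabulate _

    -- Image-finiteness supplies a list of markings, some of which may be unreachable; deciding
    -- `DRS` classically discards those.
    states : (Ms : List Marking) → ∃[ Ss ] ∀ (M : State) → value M ∈ Ms → M ∈ Ss
    states [] = [] , λ _ ()
    states (M ∷ Ms) = extend em (states Ms)
      where
      extend : Dec (DRS M) → ∃[ Ss ] (∀ (S : State) → value S ∈ Ms → S ∈ Ss) →
               ∃[ Ss ] ∀ (S : State) → value S ∈ M ∷ Ms → S ∈ Ss
      extend (yes d) (Ss , p) = (M , [ d ]) ∷ Ss , λ where
        S (here e)  → here (value-injective e)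
        S (there h) → there (p S h)
      extend (no ¬d) (Ss , p) = Ss , λ where
        -- The reachability proof `d` is irrelevant, which still suffices to derive a contradiction.
        (_ , [ d ]) (here refl) → ⊥-elim-irr (¬d d)
        S           (there h)   → p S h

    successors : ImageFinite → ∀ a M → ∃[ Ss ] ∀ M̃ → Succ a M M̃ → M̃ ∈ Ss
    successors fin a M =
      let Ms , p = fin M a
          Ss , q = states Ms
      in Ss , λ M̃ s → q M̃ (p (value M̃) s)

    module _ (a : Act) (M : State) where

      private
        ω : T → ℝ
        ω t = proj₁ (Ω t (value M))

        0<ω : ∀ t → 0ℝ < ω t
        0<ω t = proj₂ (Ω t (value M))

      RM-∅ : ∀ {H} → (∀ M̃ → Succ a M M̃ → ¬ H M̃) → RM N a M H ≈ 0ℝ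
      RM-∅ ¬H = sum-∅ (λ _ → em) {ω} λ t (M̃ , h , tr , l) → ¬H M̃ (t , tr , l) h

      RM-pos : ∀ {H M̃} → Succ a M M̃ → H M̃ → 0ℝ < RM N a M H
      RM-pos {M̃ = M̃} (t , tr , l) h = sum-pos (λ _ → em) {ω} 0<ω (M̃ , h , tr , l)

      -- Inclusion is asked for on `a`-successors only, as no other state affects the rate. This
      -- makes it possible to compare arbitrary witness sets of a modal formula.
      RM-mono-≤ : ∀ {H H′} → (∀ M̃ → Succ a M M̃ → H M̃ → H′ M̃) →
                  RM N a M H ≤ RM N a M H′
      RM-mono-≤ H⊆H′ = sum-mono-≤ (λ _ → em) {ω} (λ _ → em)
        (λ t → <⇒≤ {0ℝ} {ω t} (0<ω t))
        λ t (M̃ , h , tr , l) → M̃ , H⊆H′ M̃ (t , tr , l) h , tr , l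

      -- Disjointness of the sets of states passes to the sets of transitions by determinism; a
      -- transition with targets in both would be counted twice on the right.
      RM-⊎ : ∀ {H H₁ H₂ : Pred State 0ℓ} → (∀ M̃ → H₁ M̃ → ¬ H₂ M̃) →
             (∀ M̃ → H M̃ → H₁ M̃ ⊎ H₂ M̃) → (∀ M̃ → H₁ M̃ ⊎ H₂ M̃ → H M̃) →
             RM N a M H ≈ RM N a M H₁ + RM N a M H₂
      RM-⊎ {H} {H₁} {H₂} disjoint split merge = sum-⊎ (λ _ → em) {ω} (λ _ → em) (λ _ → em)
        (λ t (M₁ , h₁ , tr₁ , _) (M₂ , h₂ , tr₂ , _) →
           disjoint M₁ h₁ (subst H₂ (→-deterministic M tr₂ tr₁) h₂))
        (λ t (M̃ , h , tr) → Sum.map (λ h₁ → M̃ , h₁ , tr) (λ h₂ → M̃ , h₂ , tr) (split M̃ h))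
        (λ t → [ (λ (M̃ , h₁ , tr) → M̃ , merge M̃ (inj₁ h₁) , tr)
               , (λ (M̃ , h₂ , tr) → M̃ , merge M̃ (inj₂ h₂) , tr) ]′)

  -- Rates and satisfaction on the disjoint union of two nets

  module _ (N : LFSPN Act) (q : LFSPN.Pc N) (N′ : LFSPN Act) (q′ : LFSPN.Pc N′) where

    private
      S : Set
      S = States N q N′ q′

      rp : S → ℝ
      rp = RP⊎ N q N′ q′

      rm : Act → S → Pred S 0ℓ → ℝ
      rm = RM⊎ N q N′ q′

    Succ⊎ : Act → S → Pred S 0ℓ
    Succ⊎ a (inj₁ M) (inj₁ M̃) = Succ N a M M̃
    Succ⊎ a (inj₂ M) (inj₂ M̃) = Succ N′ a M M̃
    Succ⊎ a (inj₁ _) (inj₂ _) = ⊥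
    Succ⊎ a (inj₂ _) (inj₁ _) = ⊥

    successors⊎ : Net.ImageFinite N → Net.ImageFinite N′ →
                  ∀ a s → ∃[ ss ] ∀ s̃ → Succ⊎ a s s̃ → s̃ ∈ ss
    successors⊎ fin fin′ a (inj₁ M) =
      let Ss , p = successors N fin a M
      in List.map inj₁ Ss , λ { (inj₁ M̃) m → ∈-map⁺ inj₁ (p M̃ m) }
    successors⊎ fin fin′ a (inj₂ M) =
      let Ss , p = successors N′ fin′ a M
      in List.map inj₂ Ss , λ { (inj₂ M̃) m → ∈-map⁺ inj₂ (p M̃ m) }

    module _ (a : Act) where

      RM⊎-∅ : ∀ s {H} → (∀ s̃ → Succ⊎ a s s̃ → ¬ H s̃) → rm a s H ≈ 0ℝ
      RM⊎-∅ (inj₁ M) ¬H = RM-∅ N a M (¬H ∘ inj₁)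
      RM⊎-∅ (inj₂ M) ¬H = RM-∅ N′ a M (¬H ∘ inj₂)

      RM⊎-pos : ∀ s {H s̃} → Succ⊎ a s s̃ → H s̃ → 0ℝ < rm a s H
      RM⊎-pos (inj₁ M) {H} {inj₁ M̃} = RM-pos N a M {H ∘ inj₁}
      RM⊎-pos (inj₂ M) {H} {inj₂ M̃} = RM-pos N′ a M {H ∘ inj₂}

      RM⊎-mono-≤ : ∀ s {H H′} → (∀ s̃ → Succ⊎ a s s̃ → H s̃ → H′ s̃) → rm a s H ≤ rm a s H′
      RM⊎-mono-≤ (inj₁ M) H⊆H′ = RM-mono-≤ N a M (H⊆H′ ∘ inj₁)
      RM⊎-mono-≤ (inj₂ M) H⊆H′ = RM-mono-≤ N′ a M (H⊆H′ ∘ inj₂)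

      RM⊎-cong : ∀ s {H H′} → H ≐ H′ → rm a s H ≈ rm a s H′
      RM⊎-cong s {H} {H′} (H⊆H′ , H′⊆H) = ≤-antisym {rm a s H} {rm a s H′}
        (RM⊎-mono-≤ s λ _ _ → H⊆H′) (RM⊎-mono-≤ s λ _ _ → H′⊆H)

      RM⊎-⊎ : ∀ s {H H₁ H₂ : Pred S 0ℓ} → (∀ s̃ → H₁ s̃ → ¬ H₂ s̃) →
              (∀ s̃ → H s̃ → H₁ s̃ ⊎ H₂ s̃) → (∀ s̃ → H₁ s̃ ⊎ H₂ s̃ → H s̃) →
              rm a s H ≈ rm a s H₁ + rm a s H₂
      RM⊎-⊎ (inj₁ M) {_} {_} {H₂} d f g = RM-⊎ N a M {H₂ = H₂ ∘ inj₁} (d ∘ inj₁) (f ∘ inj₁) (g ∘ inj₁)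
      RM⊎-⊎ (inj₂ M) {_} {_} {H₂} d f g = RM-⊎ N′ a M {H₂ = H₂ ∘ inj₂} (d ∘ inj₂) (f ∘ inj₂) (g ∘ inj₂)

      RM⊎-nonneg : ∀ s {H} → 0ℝ ≤ rm a s H
      RM⊎-nonneg s {H} = ≤-trans {0ℝ} {rm a s ∅} {rm a s H}
        (≈⇒≤ {0ℝ} {rm a s ∅} (≈-sym {rm a s ∅} {0ℝ} (RM⊎-∅ s λ _ _ ())))
        (RM⊎-mono-≤ s λ _ _ ())

    infix 4 _⊨_

    -- The equivalences below give each connective one reading for both nets, which spares the later
    -- inductions a case split.
    _⊨_ : S → Formula Act → Set₁
    inj₁ M ⊨ Φ = Sat N q M Φ
    inj₂ M ⊨ Φ = Sat N′ q′ M Φ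

    ⊨-⊤ : ∀ s → s ⊨ ⊤′
    ⊨-⊤ (inj₁ _) = _
    ⊨-⊤ (inj₂ _) = _

    ⊨-¬ : ∀ s {Φ} → s ⊨ ¬′ Φ ⇔ (¬ s ⊨ Φ)
    ⊨-¬ (inj₁ _) = ⇔-id _
    ⊨-¬ (inj₂ _) = ⇔-id _

    ⊨-∧ : ∀ s {Φ Ψ} → s ⊨ Φ ∧′ Ψ ⇔ (s ⊨ Φ × s ⊨ Ψ)
    ⊨-∧ (inj₁ _) = ⇔-id _
    ⊨-∧ (inj₂ _) = ⇔-id _

    ⊨-∇ : ∀ s {a} → s ⊨ ∇ a ⇔ (∀ s̃ → ¬ Succ⊎ a s s̃)
    ⊨-∇ (inj₁ M) = mk⇔
      (λ { (lift h) (inj₁ _) (t , (e , _) , l) → h t l e })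
      (λ { h → lift λ { t refl e → let M̃ , m = Ena⇒Succ N M e in h (inj₁ M̃) m } })
    ⊨-∇ (inj₂ M) = mk⇔
      (λ { (lift h) (inj₂ _) (t , (e , _) , l) → h t l e })
      (λ { h → lift λ { t refl e → let M̃ , m = Ena⇒Succ N′ M e in h (inj₂ M̃) m } })

    ⊨-≀ : ∀ s {r} → s ⊨ ≀ r ⇔ rp s ≈ r
    ⊨-≀ (inj₁ _) = mk⇔ lower lift
    ⊨-≀ (inj₂ _) = mk⇔ lower lift

    -- A rate depends only on the part of the set in the net of `s`, so witness sets may be padded
    -- with the empty set or restricted.
    ⊨-⟨⟩ : ∀ s {a λ′ Φ} → s ⊨ ⟨ a ⟩[ λ′ ] Φ ⇔
           Σ (Pred S 0ℓ) λ H → rm a s H ≥ proj₁ λ′ × (∀ s̃ → H s̃ → s̃ ⊨ Φ)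
    ⊨-⟨⟩ (inj₁ _) = mk⇔
      (λ (H , r , h) → [ H , ∅ ]′ , r , λ { (inj₁ M̃) → h M̃ })
      (λ (H , r , h) → H ∘ inj₁ , r , h ∘ inj₁)
    ⊨-⟨⟩ (inj₂ _) = mk⇔
      (λ (H , r , h) → [ ∅ , H ]′ , r , λ { (inj₂ M̃) → h M̃ })
      (λ (H , r , h) → H ∘ inj₂ , r , h ∘ inj₂)

    module _ (fin : Net.ImageFinite N) (fin′ : Net.ImageFinite N′) where

      -- Bisimilar states satisfy the same formulas

      module _ {_∼_ : Rel S 0ℓ} (B : IsFluidBisimulation N q N′ q′ _∼_) where

        open IsFluidBisimulation B
        private module ∼ = IsEquivalence isEquivalence

        Saturation : List S → Pred S 0ℓ
        Saturation xs s = Any (_∼ s) xs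

        -- Induction on the list: the class of `x` either lies in the union already or is disjoint
        -- from it. In the second case rates add, and `RM-resp` handles the new class.
        RM⊎-Saturation : ∀ a {s₁ s₂} → s₁ ∼ s₂ → ∀ xs →
          rm a s₁ (Saturation xs) ≈ rm a s₂ (Saturation xs)
        RM⊎-Saturation a {s₁} {s₂} s₁∼s₂ [] =
          ≈-trans {rm a s₁ (Saturation [])} {0ℝ} {rm a s₂ (Saturation [])}
            (RM⊎-∅ a s₁ λ _ _ ())
            (≈-sym {rm a s₂ (Saturation [])} {0ℝ} (RM⊎-∅ a s₂ λ _ _ ()))
        RM⊎-Saturation a {s₁} {s₂} s₁∼s₂ (x ∷ xs) = extend em
          where
          U  = Saturation xs
          U⁺ = Saturation (x ∷ xs)

          extend : Dec (U x) → rm a s₁ U⁺ ≈ rm a s₂ U⁺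
          extend (yes x∈U) =
            ≈-trans {rm a s₁ U⁺} {rm a s₁ U} {rm a s₂ U⁺} (RM⊎-cong a s₁ U⁺≐U)
              (≈-trans {rm a s₁ U} {rm a s₂ U} {rm a s₂ U⁺} (RM⊎-Saturation a s₁∼s₂ xs)
                (≈-sym {rm a s₂ U⁺} {rm a s₂ U} (RM⊎-cong a s₂ U⁺≐U)))
            where
            U⁺≐U : U⁺ ≐ U
            U⁺≐U = (λ { (here x∼s) → Any.map (λ y∼x → ∼.trans y∼x x∼s) x∈U ; (there u) → u })
                 , there
          extend (no x∉U) =
            ≈-trans {rm a s₁ U⁺} {rm a s₁ (x ∼_) + rm a s₁ U} {rm a s₂ U⁺} (split s₁)
              (≈-trans {rm a s₁ (x ∼_) + rm a s₁ U} {rm a s₂ (x ∼_) + rm a s₂ U} {rm a s₂ U⁺}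
                (+-cong {rm a s₁ (x ∼_)} {rm a s₂ (x ∼_)} {rm a s₁ U} {rm a s₂ U}
                  (RM-resp s₁∼s₂ (x ∼_) (x , (λ h → h) , (λ h → h)) a)
                  (RM⊎-Saturation a s₁∼s₂ xs))
                (≈-sym {rm a s₂ U⁺} {rm a s₂ (x ∼_) + rm a s₂ U} (split s₂)))
            where
            split : ∀ s → rm a s U⁺ ≈ rm a s (x ∼_) + rm a s U
            split s = RM⊎-⊎ a s
              (λ _ x∼s u → x∉U (Any.map (λ y∼s → ∼.trans y∼s (∼.sym x∼s)) u))
              (λ _ → Any.toSum) (λ _ → Any.fromSum)

        ∼⇒⊨ : ∀ Φ {s₁ s₂} → s₁ ∼ s₂ → s₁ ⊨ Φ → s₂ ⊨ Φ
        ∼⇒⊨ ⊤′ {s₂ = s₂} _ _ = ⊨-⊤ s₂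
        ∼⇒⊨ (¬′ Φ) {s₁} {s₂} e h = from (⊨-¬ s₂) (to (⊨-¬ s₁) h ∘ ∼⇒⊨ Φ (∼.sym e))
        ∼⇒⊨ (Φ ∧′ Ψ) {s₁} {s₂} e h =
          from (⊨-∧ s₂) (Product.map (∼⇒⊨ Φ e) (∼⇒⊨ Ψ e) (to (⊨-∧ s₁) h))
        ∼⇒⊨ (∇ a) {s₁} {s₂} e h = from (⊨-∇ s₂) λ s̃ m →
          -- An `a`-successor of `s₂` would give `s₂` a positive rate into its class, while `s₁` has
          -- rate zero into every set.
          <-irrefl {0ℝ} (<-≤-trans {0ℝ} {rm a s₂ (s̃ ∼_)} {0ℝ}
            (RM⊎-pos a s₂ m ∼.refl)
            (≤-trans {rm a s₂ (s̃ ∼_)} {rm a s₁ (s̃ ∼_)} {0ℝ}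
              (≈⇒≤ {rm a s₂ (s̃ ∼_)} {rm a s₁ (s̃ ∼_)}
                (RM-resp (∼.sym e) (s̃ ∼_) (s̃ , (λ x → x) , (λ x → x)) a))
              (≈⇒≤ {rm a s₁ (s̃ ∼_)} {0ℝ} (RM⊎-∅ a s₁ λ s̃′ m′ _ → to (⊨-∇ s₁) h s̃′ m′))))
        ∼⇒⊨ (≀ r) {s₁} {s₂} e h = from (⊨-≀ s₂)
          (≈-trans {rp s₂} {rp s₁} {r} (RP-resp (∼.sym e)) (to (⊨-≀ s₁) h))
        ∼⇒⊨ (⟨ a ⟩[ λ′ ] Φ) {s₁} {s₂} e h =
          let H , λ≤rm , H⊨Φ = to (⊨-⟨⟩ s₁) h
              ss , complete  = successors⊎ fin fin′ a s₁
              H?             = λ s → em {P = H s}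
              -- `H` need not be a union of classes. Saturating the finitely many `a`-successors of
              -- `s₁` in `H` loses none of the rate of `s₁`, and `s₂` has the same rate into the
              -- result.
              xs             = filter H? ss
              U              = Saturation xs
          in from (⊨-⟨⟩ s₂)
            ( U
            , ≤-trans {proj₁ λ′} {rm a s₁ H} {rm a s₂ U} λ≤rm
                (≤-trans {rm a s₁ H} {rm a s₁ U} {rm a s₂ U}
                  (RM⊎-mono-≤ a s₁ λ s̃ m h →
                    Any.map (λ { refl → ∼.refl }) (∈-filter⁺ H? (complete s̃ m) h))
                  (≈⇒≤ {rm a s₁ U} {rm a s₂ U} (RM⊎-Saturation a e xs)))
            -- Each state of `U` is bisimilar to some `x` in `H`, so the induction hypothesis for
            -- `Φ` applies.
            , λ s̃ u → let x , x∈xs , x∼s̃ = find u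
                      in ∼⇒⊨ Φ x∼s̃ (H⊨Φ x (proj₂ (∈-filter⁻ H? {xs = ss} x∈xs)))
            )

      -- Logical equivalence is a fluid bisimulation

      infix 4 _≋_ _≋₀_

      _≋_ : S → S → Set₁
      s₁ ≋ s₂ = ∀ Φ → s₁ ⊨ Φ ⇔ s₂ ⊨ Φ

      ≋-sym : ∀ s₁ s₂ → s₁ ≋ s₂ → s₂ ≋ s₁
      ≋-sym _ _ e Φ = ⇔-sym (e Φ)

      -- A separating formula true only in `s₂` is replaced by its negation, so the direction can be
      -- prescribed.
      distinguish : ∀ s₁ s₂ → ¬ s₁ ≋ s₂ → ∃[ Φ ] s₁ ⊨ Φ × ¬ s₂ ⊨ Φ
      distinguish s₁ s₂ s₁≭s₂ = decidable-stable em λ ¬∃ → s₁≭s₂ λ Φ → mk⇔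
        (λ h₁ → decidable-stable em λ ¬h₂ → ¬∃ (Φ , h₁ , ¬h₂))
        (λ h₂ → decidable-stable em λ ¬h₁ →
          ¬∃ (¬′ Φ , from (⊨-¬ s₁) ¬h₁ , λ h → to (⊨-¬ s₂) h h₂))

      -- The conjunction of formulas true in `x` and false in `y`, one for each listed `y`
      -- inequivalent to `x`. It characterises the class of `x` within the list only, which keeps it
      -- finite.
      characteristic : ∀ x ss → ∃[ Φ ] x ⊨ Φ × (∀ {s} → s ∈ ss → s ⊨ Φ → x ≋ s)
      characteristic x [] = ⊤′ , ⊨-⊤ x , λ ()
      characteristic x (y ∷ ss) = extend em (characteristic x ss)
        where
        extend : Dec (x ≋ y) → ∃[ Φ ] x ⊨ Φ × (∀ {s} → s ∈ ss → s ⊨ Φ → x ≋ s) →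
                 ∃[ Φ ] x ⊨ Φ × (∀ {s} → s ∈ y ∷ ss → s ⊨ Φ → x ≋ s)
        extend (yes x≋y) (Φ , x⊨Φ , char) = Φ , x⊨Φ , λ where
          (here refl) _   → x≋y
          (there s∈ss) s⊨Φ → char s∈ss s⊨Φ
        extend (no x≭y) (Φ , x⊨Φ , char) =
          let Ψ , x⊨Ψ , y⊭Ψ = distinguish x y x≭y
          in Ψ ∧′ Φ , from (⊨-∧ x) (x⊨Ψ , x⊨Φ) , λ where
            (here refl) h        → contradiction (proj₁ (to (⊨-∧ y) h)) y⊭Ψ
            {s} (there s∈ss) h → char s∈ss (proj₂ (to (⊨-∧ s) h))

      -- Bisimulations live in Set, whereas logical equivalence lives in Set₁.
      _≋₀_ : Rel S 0ℓ
      s₁ ≋₀ s₂ = True (em {P = s₁ ≋ s₂})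

      RM⊎-≋-≤ : ∀ s₁ s₂ → s₁ ≋ s₂ → ∀ {H} → IsClassOf _≋₀_ H →
                ∀ a → rm a s₁ H ≤ rm a s₂ H
      RM⊎-≋-≤ s₁ s₂ s₁≋s₂ {H} (x , H⊆x , x⊆H) a = by-cases em
        where
        by-cases : Dec (∃[ s̃ ] Succ⊎ a s₁ s̃ × H s̃) → rm a s₁ H ≤ rm a s₂ H
        -- The modality takes only positive rates, so rate zero is treated apart.
        by-cases (no ¬∃) = ≤-trans {rm a s₁ H} {0ℝ} {rm a s₂ H}
          (≈⇒≤ {rm a s₁ H} {0ℝ} (RM⊎-∅ a s₁ λ s̃ m h → ¬∃ (s̃ , m , h)))
          (RM⊎-nonneg a s₂)
        by-cases (yes (s̃ , m , h)) =
          let ss , complete   = successors⊎ fin fin′ a s₂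
              Φ , x⊨Φ , char  = characteristic x ss
              λ′              = rm a s₁ H , RM⊎-pos a s₁ m h
              s₁⊨⟨⟩           = from (⊨-⟨⟩ s₁ {a} {λ′} {Φ})
                                  ( H , ≤-refl {rm a s₁ H}
                                  , λ _ h → to (toWitness (H⊆x h) Φ) x⊨Φ)
              H₂ , λ≤rm , H₂⊨ = to (⊨-⟨⟩ s₂) (to (s₁≋s₂ (⟨ a ⟩[ λ′ ] Φ)) s₁⊨⟨⟩)
          -- The set `H₂` is any witness for `s₂`; its `a`-successors of `s₂` satisfy `Φ`, hence are
          -- equivalent to `x` and lie in `H`.
          in ≤-trans {rm a s₁ H} {rm a s₂ H₂} {rm a s₂ H} λ≤rm
               (RM⊎-mono-≤ a s₂ λ s̃ m h → x⊆H (fromWitness (char (complete s̃ m) (H₂⊨ s̃ h))))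

      ≋₀-isFluidBisimulation : LogicallyEquivalent N q N′ q′ →
                               IsFluidBisimulation N q N′ q′ _≋₀_
      ≋₀-isFluidBisimulation M₀≋M₀′ = record
        { isEquivalence = record
          { refl  = fromWitness λ _ → ⇔-id _
          ; sym   = λ {s₁} {s₂} e → fromWitness (≋-sym s₁ s₂ (toWitness e))
          ; trans = λ e f → fromWitness λ Φ → toWitness f Φ ⇔-∘ toWitness e Φ
          }
        ; initial = fromWitness M₀≋M₀′
        -- The formula `≀ (rp s₂)` holds in `s₂` and is carried over to `s₁`.
        ; RP-resp = λ {s₁} {s₂} e → to (⊨-≀ s₁)
            (from (toWitness e (≀ (rp s₂))) (from (⊨-≀ s₂) (≈-refl {rp s₂})))
        ; RM-resp = λ {s₁} {s₂} e H c a → ≤-antisym {rm a s₁ H} {rm a s₂ H}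
            (RM⊎-≋-≤ s₁ s₂ (toWitness e) c a)
            (RM⊎-≋-≤ s₂ s₁ (≋-sym s₁ s₂ (toWitness e)) c a)
        }

open LFSPN using (Pc)
open Net using (ImageFinite)

theorem8p2 : (em : ∀ {ℓ} → ExcludedMiddle ℓ)
    (Act : Set) (N N′ : LFSPN Act)
    (q : Pc N) → (∀ p → p ≡ q) →
    (q′ : Pc N′) → (∀ p → p ≡ q′) →
    ImageFinite N → ImageFinite N′ →
    Classical.FluidBisimilar em N q N′ q′ ⇔ Classical.LogicallyEquivalent em N q N′ q′
theorem8p2 em Act N N′ q _ q′ _ fin fin′ = mk⇔
  (λ (_ , B) Φ →
    let open Classical.IsFluidBisimulation B
        ∼⇒⊨-Φ = ∼⇒⊨ em N q N′ q′ fin fin′ B Φ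
    in mk⇔ (∼⇒⊨-Φ initial) (∼⇒⊨-Φ (IsEquivalence.sym isEquivalence initial)))
  (λ M₀≋M₀′ → _ , ≋₀-isFluidBisimulation em N q N′ q′ fin fin′ M₀≋M₀′)
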